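{- Let $q$ be a prime power, $n\ge 1$ an integer, and $H(x)\in\mathbb{F}_{q^n}[x]$. Let $P_H=\{\gamma\in\mathbb{F}_{q^n} : x+\gamma\,\mathrm{Tr}(H(x)) \text{ is a permutation polynomial over } \mathbb{F}_{q^n}\}$, let $S=\{\mathrm{Tr}(H(x)) : x\in\mathbb{F}_{q^n}\}\subseteq\mathbb{F}_q$, and for $b\in S$ let $I_b=\{x\in\mathbb{F}_{q^n} : \mathrm{Tr}(H(x))=b\}$. Then $$P_H=\mathbb{F}_{q^n}\setminus\bigcup_{\substack{b,c\in S\\ b\ne c}}\left\{\frac{y-x}{b-c} : x\in I_b,\ y\in I_c\right\}.$$
   Context: $\mathrm{Tr}:\mathbb{F}_{q^n}\to\mathbb{F}_q$ is the trace map $\mathrm{Tr}(x)=x+x^q+\cdots+x^{q^{n-1}}$. A polynomial $f$ over $\mathbb{F}_{q^n}$ is a permutation polynomial if the map $x\mapsto f(x)$ is a bijection of $\mathbb{F}_{q^n}$ onto itself. -}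

module Defs where

open import Algebra.Apartness.Bundles using (HeytingField)
import Algebra.Apartness.Properties.HeytingCommutativeRing as HeytingProperties
open import Algebra.Bundles using (CommutativeRing; RawSemiring; Semiring)
import Algebra.Definitions.RawSemiring as RawSemiringDefinitions
import Algebra.Properties.CommutativeMonoid.Sum as CommutativeMonoidSum
import Algebra.Properties.CommutativeSemiring.Binomial as BinomialTheorem
import Algebra.Properties.CommutativeSemiring.Exp as Exponentiation
import Algebra.Properties.Group as GroupProperties
import Algebra.Properties.Semiring.Mult as Multiplication
open import Data.Fin using (Fin; zero; suc; toℕ; inject₁; fromℕ; punchIn)
open import Data.Fin.Permutation using (Permutation; permutation; _⟨$⟩ʳ_)
open import Data.Fin.Properties using (any?; toℕ<n; toℕ-inject₁; toℕ-fromℕ; punchInᵢ≢i)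
import Data.Fin.Properties as Fin
open import Data.List using (List; []; _∷_; map)
open import Data.Nat as ℕ using (ℕ; zero; suc; _!; _∸_; _≤_; _<_; s≤s; z≤n)
open import Data.Nat.Combinatorics using (_C_; nCk≡n!/k![n-k]!; k![n∸k]!∣n!; nCn≡1)
open import Data.Nat.Divisibility using (_∣_; divides; ∣⇒≤; m∣m*n)
open import Data.Nat.DivMod using (m/n*n≡m)
open import Data.Nat.Primality using (Prime; euclidsLemma; ¬prime[0]; ¬prime[1])
import Data.Nat.Properties as ℕ
open import Data.Product using (Σ; Σ-syntax; ∃; ∃₂; _×_; _,_; proj₁; proj₂)
open import Data.Sum using (_⊎_; inj₁; inj₂)
open import Function.Bundles using (Inverse)
open import Function.Definitions using (Bijective)
open import Function.Properties.Inverse using (Inverse⇒Injection)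
open import Level using (Level; _⊔_) renaming (suc to lsuc)
open import Relation.Binary.Definitions using (Decidable)
open import Relation.Binary.PropositionalEquality as ≡ using (_≡_)
import Relation.Binary.Reasoning.Setoid as SetoidReasoning
open import Relation.Nullary using (¬_; yes; no; contradiction)
open import Relation.Nullary.Decidable using (via-injection)
open import Relation.Unary using (Pred)

private
  variable
    c ℓ₁ ℓ₂ : Level

IsPrimePower : ℕ → Set
IsPrimePower q = ∃₂ λ p k → Prime p × 1 ≤ k × q ≡ p ℕ.^ k

record FiniteField c ℓ₁ ℓ₂ (N : ℕ) : Set (lsuc (c ⊔ ℓ₁ ⊔ ℓ₂)) where
  field
    heytingField : HeytingField c ℓ₁ ℓ₂

  open HeytingField heytingField public hiding (zero)

  commutativeRing : CommutativeRing c ℓ₁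
  commutativeRing = record { isCommutativeRing = isCommutativeRing }

  open CommutativeRing commutativeRing public
    using ( semiring; commutativeSemiring; +-group
          ; +-commutativeMonoid; *-commutativeMonoid)

  rawSemiring : RawSemiring c ℓ₁
  rawSemiring = Semiring.rawSemiring semiring

  field
    enumeration : Inverse setoid (≡.setoid (Fin N))

-- The trace formula x + x^q + ⋯ + x^(q^(n-1)).  It is stated over a raw
-- semiring because it is needed both for field elements and for polynomials.
traceFormula : (R : RawSemiring c ℓ₁) (q n : ℕ) → RawSemiring.Carrier R → RawSemiring.Carrier R
traceFormula R q n x = sum {n} λ i → x ^ (q ℕ.^ toℕ i)
  where open RawSemiringDefinitions R using (sum; _^_)

private

  p∤k! : ∀ {p} → Prime p → ∀ k → k < p → ¬ (p ∣ k !)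
  p∤k! {zero}        pr k       _   _    = ¬prime[0] pr
  p∤k! {suc zero}    pr k       _   _    = ¬prime[1] pr
  p∤k! {suc (suc p)} pr zero    _   p∣1  = ℕ.<⇒≱ (s≤s (s≤s z≤n)) (∣⇒≤ p∣1)
  p∤k! {suc (suc p)} pr (suc k) k<p p∣k! with euclidsLemma (suc k) (k !) pr p∣k!
  ... | inj₁ p∣1+k = ℕ.<⇒≱ k<p (∣⇒≤ p∣1+k)
  ... | inj₂ p∣k!′ = p∤k! pr k (ℕ.<-trans (ℕ.n<1+n k) k<p) p∣k!′

  p∣pCk : ∀ {p} → Prime p → ∀ k → 0 < k → k < p → p ∣ p C k
  p∣pCk {zero}  pr k 0<k k<p = contradiction pr ¬prime[0]
  p∣pCk {suc p} pr (suc k) 0<k k<p = dividesBinomial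
    (euclidsLemma (suc p C suc k) (suc k ! ℕ.* (p ∸ k) !) pr divisible)
    where
    instance _ = suc k ℕ.!* (p ∸ k) !≢0

    divisible : suc p ∣ (suc p C suc k) ℕ.* (suc k ! ℕ.* (p ∸ k) !)
    divisible = ≡.subst (suc p ∣_) (≡.sym (≡.trans
      (≡.cong (ℕ._* (suc k ! ℕ.* (p ∸ k) !)) (nCk≡n!/k![n-k]! (ℕ.<⇒≤ k<p)))
      (m/n*n≡m (k![n∸k]!∣n! (ℕ.<⇒≤ k<p))))) (m∣m*n (p !))

    p∤product : ¬ (suc p ∣ suc k ! ℕ.* (p ∸ k) !)
    p∤product p∣! with euclidsLemma (suc k !) ((p ∸ k) !) pr p∣!
    ... | inj₁ p∣k!     = p∤k! pr (suc k) k<p p∣k!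
    ... | inj₂ p∣[p-k]! = p∤k! pr (p ∸ k) (s≤s (ℕ.m∸n≤m p k)) p∣[p-k]!

    dividesBinomial : suc p ∣ suc p C suc k ⊎ suc p ∣ suc k ! ℕ.* (p ∸ k) ! → suc p ∣ suc p C suc k
    dividesBinomial (inj₁ p∣C) = p∣C
    dividesBinomial (inj₂ p∣!) = contradiction p∣! p∤product

module FiniteFieldProperties {N : ℕ} (L : FiniteField c ℓ₁ ℓ₂ N) where

  open FiniteField L
  open Inverse enumeration using (to; from; to-cong; strictlyInverseˡ; strictlyInverseʳ)
  open HeytingProperties (HeytingField.heytingCommutativeRing heytingField)
    using (invertibleʳ⇒#; x-0≈x; x#0y#0→xy#0; 1#0)
  open GroupProperties +-group using () renaming (∙-cancelˡ to +-cancelˡ)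
  open Exponentiation commutativeSemiring using (_^_; ^-cong; ^-congˡ; ^-congʳ; ^-assocʳ)
  open Multiplication semiring
    using (×-congʳ; ×-congˡ; ×-homo-1; ×-assocˡ; ×1-homo-*; ×-assoc-*) renaming (_×_ to _·_)
  private
    module Sum  = CommutativeMonoidSum +-commutativeMonoid
    module Prod = CommutativeMonoidSum *-commutativeMonoid
  open SetoidReasoning setoid

  _≟_ : Decidable _≈_
  _≟_ = via-injection (Inverse⇒Injection enumeration) Fin._≟_

  ≉⇒# : ∀ {x y} → ¬ (x ≈ y) → x # y
  ≉⇒# {x} {y} x≉y with any? (λ i → ((x - y) * from i) ≟ 1#)
  ... | yes (i , eq) = invertibleʳ⇒# (from i , eq)
  ... | no  none     = contradiction (proj₁ (tight x y) ¬x#y) x≉y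
    where
    ¬x#y : ¬ (x # y)
    ¬x#y x#y with #⇒invertible x#y
    ... | d , _ , eq = none (to d , trans (*-congˡ (strictlyInverseʳ d)) eq)

  #⇒≉ : ∀ {x y} → x # y → ¬ (x ≈ y)
  #⇒≉ {x} {y} x#y x≈y = proj₂ (tight x y) x≈y x#y

  private

    cancel : ∀ {x} → ¬ (x ≈ 0#) → ∀ {y z} → x * y ≈ x * z → y ≈ z
    cancel {x} x≉0 {y} {z} eq with #⇒invertible (≉⇒# x≉0)
    ... | d , dx≈1 , _ = begin
      y                ≈⟨ undo y ⟨
      d * (x * y)      ≈⟨ *-congˡ eq ⟩
      d * (x * z)      ≈⟨ undo z ⟩
      z                ∎
      where
      undo : ∀ w → d * (x * w) ≈ w
      undo w = begin
        d * (x * w)        ≈⟨ *-assoc d x w ⟨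
        d * x * w          ≈⟨ *-congʳ (*-congˡ (x-0≈x x)) ⟨
        d * (x - 0#) * w   ≈⟨ *-congʳ dx≈1 ⟩
        1# * w             ≈⟨ *-identityˡ w ⟩
        w                  ∎

    -- Σ x = Σ (x + 1) over the field gives |L|·1 = 0.
    N·1≈0 : N · 1# ≈ 0#
    N·1≈0 = +-cancelˡ (Sum.sum from) (N · 1#) 0# (begin
      Sum.sum from + N · 1#                         ≈⟨ +-congˡ (Sum.sum-replicate N) ⟨
      Sum.sum from + Sum.sum {N} (λ _ → 1#)         ≈⟨ Sum.∑-distrib-+ from (λ _ → 1#) ⟨
      Sum.sum (λ i → from i + 1#)                   ≈⟨ Sum.sum-cong-≋ (λ i → strictlyInverseʳ (from i + 1#)) ⟨
      Sum.sum (λ i → from (π ⟨$⟩ʳ i))               ≈⟨ Sum.sum-permute from π ⟨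
      Sum.sum from                                  ≈⟨ +-identityʳ _ ⟨
      Sum.sum from + 0#                             ∎)
      where
      shift : ∀ {a b} → a + b ≈ 0# → ∀ i → to (from (to (from i + a)) + b) ≡ i
      shift {a} {b} a+b≈0 i = ≡.trans (to-cong (begin
        from (to (from i + a)) + b   ≈⟨ +-congʳ (strictlyInverseʳ _) ⟩
        from i + a + b               ≈⟨ +-assoc _ _ _ ⟩
        from i + (a + b)             ≈⟨ +-congˡ a+b≈0 ⟩
        from i + 0#                  ≈⟨ +-identityʳ _ ⟩
        from i                       ∎)) (strictlyInverseˡ i)
      π : Permutation N N
      π = permutation (λ i → to (from i + 1#)) (λ i → to (from i + (- 1#)))
            (shift (-‿inverseˡ 1#)) (shift (-‿inverseʳ 1#))

    p^j·1≈0⇒p·1≈0 : ∀ p j → (p ℕ.^ j) · 1# ≈ 0# → p · 1# ≈ 0#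
    p^j·1≈0⇒p·1≈0 p zero    eq = contradiction (trans (sym (×-homo-1 1#)) eq) (#⇒≉ 1#0)
    p^j·1≈0⇒p·1≈0 p (suc j) eq with (p · 1#) ≟ 0#
    ... | yes p·1≈0 = p·1≈0
    ... | no  p·1≉0 = p^j·1≈0⇒p·1≈0 p j (cancel p·1≉0 (begin
      p · 1# * (p ℕ.^ j) · 1#   ≈⟨ ×1-homo-* p (p ℕ.^ j) ⟨
      (p ℕ.^ suc j) · 1#        ≈⟨ eq ⟩
      0#                        ≈⟨ zeroʳ _ ⟨
      p · 1# * 0#               ∎))

    product≉0 : ∀ {m} (t : Fin m → Carrier) → (∀ i → ¬ (t i ≈ 0#)) → ¬ (Prod.sum t ≈ 0#)
    product≉0 {zero}  t t≉0 = #⇒≉ 1#0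
    product≉0 {suc m} t t≉0 = #⇒≉ (x#0y#0→xy#0 (≉⇒# (t≉0 zero))
                                   (≉⇒# (product≉0 (λ i → t (suc i)) (λ i → t≉0 (suc i)))))

    0^m≈0 : ∀ m → 0 < m → 0# ^ m ≈ 0#
    0^m≈0 (suc m) _ = zeroˡ _

    unit : Carrier → Carrier
    unit a with a ≟ 0#
    ... | yes _ = 1#
    ... | no  _ = a

    unit≉0 : ∀ a → ¬ (unit a ≈ 0#)
    unit≉0 a with a ≟ 0#
    ... | yes _   = #⇒≉ 1#0
    ... | no  a≉0 = a≉0

    unit-cong : ∀ {a b} → a ≈ b → unit a ≈ unit b
    unit-cong {a} {b} a≈b with a ≟ 0# | b ≟ 0#
    ... | yes _   | yes _   = refl
    ... | yes a≈0 | no  b≉0 = contradiction (trans (sym a≈b) a≈0) b≉0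
    ... | no  a≉0 | yes b≈0 = contradiction (trans a≈b b≈0) a≉0
    ... | no  _   | no  _   = a≈b

  -- The product of the nonzero elements is invariant under scaling by a
  -- nonzero x, which gives x^(N-1) = 1.
  x^N≈x : ∀ x → x ^ N ≈ x
  x^N≈x x with x ≟ 0#
  ... | yes x≈0 = begin
    x ^ N    ≈⟨ ^-congˡ N x≈0 ⟩
    0# ^ N   ≈⟨ 0^m≈0 N (inhabited (to 0#)) ⟩
    0#       ≈⟨ x≈0 ⟨
    x        ∎
    where
    inhabited : ∀ {m} → Fin m → 0 < m
    inhabited zero    = s≤s z≤n
    inhabited (suc _) = s≤s z≤n
  ... | no x≉0 = cancel (product≉0 g (λ i → unit≉0 (from i))) (begin
    Prod.sum g * x ^ N                   ≈⟨ *-comm _ _ ⟩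
    x ^ N * Prod.sum g                   ≈⟨ *-congʳ x^N ⟩
    x * Prod.sum h * Prod.sum g          ≈⟨ *-assoc _ _ _ ⟩
    x * (Prod.sum h * Prod.sum g)        ≈⟨ *-congˡ (Prod.∑-distrib-+ h g) ⟨
    x * Prod.sum (λ i → h i * g i)       ≈⟨ *-congˡ (Prod.sum-cong-≋ scaled) ⟨
    x * Prod.sum (λ i → g (π ⟨$⟩ʳ i))    ≈⟨ *-congˡ (Prod.sum-permute g π) ⟨
    x * Prod.sum g                       ≈⟨ *-comm _ _ ⟩
    Prod.sum g * x                       ∎)
    where
    g h : Fin N → Carrier
    g i = unit (from i)

    factor : Carrier → Carrier
    factor a with a ≟ 0#
    ... | yes _ = 1#
    ... | no  _ = x
    h i = factor (from i)

    x⁻¹ : Carrier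
    x⁻¹ = proj₁ (#⇒invertible (≉⇒# x≉0))

    xx⁻¹≈1 : x * x⁻¹ ≈ 1#
    xx⁻¹≈1 = trans (*-congʳ (sym (x-0≈x x))) (proj₂ (proj₂ (#⇒invertible (≉⇒# x≉0))))

    rescale : ∀ {a b} → b * a ≈ 1# → ∀ i → to (b * from (to (a * from i))) ≡ i
    rescale {a} {b} ba≈1 i = ≡.trans (to-cong (begin
      b * from (to (a * from i))   ≈⟨ *-congˡ (strictlyInverseʳ _) ⟩
      b * (a * from i)             ≈⟨ *-assoc _ _ _ ⟨
      b * a * from i               ≈⟨ *-congʳ ba≈1 ⟩
      1# * from i                  ≈⟨ *-identityˡ _ ⟩
      from i                       ∎)) (strictlyInverseˡ i)

    π : Permutation N N
    π = permutation (λ i → to (x * from i)) (λ i → to (x⁻¹ * from i))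
          (rescale xx⁻¹≈1) (rescale (trans (*-comm _ _) xx⁻¹≈1))

    unit-scale : ∀ a → unit (x * a) ≈ factor a * unit a
    unit-scale a with a ≟ 0# | (x * a) ≟ 0#
    ... | yes _   | yes _    = sym (*-identityˡ 1#)
    ... | yes a≈0 | no  xa≉0 = contradiction (trans (*-congˡ a≈0) (zeroʳ x)) xa≉0
    ... | no  a≉0 | yes xa≈0 = contradiction (cancel x≉0 (trans xa≈0 (sym (zeroʳ x)))) a≉0
    ... | no  _   | no  _    = refl

    scaled : ∀ i → g (π ⟨$⟩ʳ i) ≈ h i * g i
    scaled i = trans (unit-cong (strictlyInverseʳ _)) (unit-scale (from i))

    factor-0 : ∀ {a} → a ≈ 0# → factor a ≈ 1#
    factor-0 {a} a≈0 with a ≟ 0#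
    ... | yes _   = refl
    ... | no  a≉0 = contradiction a≈0 a≉0

    factor-≉0 : ∀ {a} → ¬ (a ≈ 0#) → factor a ≈ x
    factor-≉0 {a} a≉0 with a ≟ 0#
    ... | yes a≈0 = contradiction a≈0 a≉0
    ... | no  _   = refl

    extract : ∀ {m} (t : Fin m → Carrier) z → t z ≈ 1# → (∀ i → ¬ (i ≡ z) → t i ≈ x) →
              x ^ m ≈ x * Prod.sum t
    extract {suc m} t z tz≈1 t≈x = *-congˡ (begin
      x ^ m                                      ≈⟨ Prod.sum-replicate m ⟨
      Prod.sum {m} (λ _ → x)                     ≈⟨ Prod.sum-cong-≋ (λ j → t≈x (punchIn z j) (punchInᵢ≢i z j)) ⟨
      Prod.sum (λ j → t (punchIn z j))           ≈⟨ *-identityˡ _ ⟨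
      1# * Prod.sum (λ j → t (punchIn z j))      ≈⟨ *-congʳ tz≈1 ⟨
      t z * Prod.sum (λ j → t (punchIn z j))     ≈⟨ Prod.sum-remove {i = z} t ⟨
      Prod.sum t                                 ∎)

    x^N : x ^ N ≈ x * Prod.sum h
    x^N = extract h (to 0#) (factor-0 (strictlyInverseʳ 0#)) λ i i≢z → factor-≉0 λ i≈0 →
      i≢z (≡.trans (≡.sym (strictlyInverseˡ i)) (to-cong i≈0))

  module _ {p} (pr : Prime p) (p·1≈0 : p · 1# ≈ 0#) where

    private

      p∣m⇒m·x≈0 : ∀ {m} → p ∣ m → ∀ x → m · x ≈ 0#
      p∣m⇒m·x≈0 {m} (divides d m≡dp) x = begin
        m · x              ≈⟨ ×-congˡ (≡.trans m≡dp (ℕ.*-comm d p)) ⟩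
        (p ℕ.* d) · x      ≈⟨ ×-assocˡ x p d ⟨
        p · (d · x)        ≈⟨ ×-congʳ p (*-identityˡ _) ⟨
        p · (1# * d · x)   ≈⟨ ×-assoc-* p 1# (d · x) ⟨
        p · 1# * d · x     ≈⟨ *-congʳ p·1≈0 ⟩
        0# * d · x         ≈⟨ zeroˡ _ ⟩
        0#                 ∎

      frobenius-+ : ∀ x y → (x + y) ^ p ≈ x ^ p + y ^ p
      frobenius-+ = expand pr p∣m⇒m·x≈0
        where
        expand : ∀ {p} → Prime p → (∀ {m} → p ∣ m → ∀ x → m · x ≈ 0#) →
                 ∀ x y → (x + y) ^ p ≈ x ^ p + y ^ p
        expand {zero}  pr kill x y = contradiction pr ¬prime[0]
        expand {suc p} pr kill x y = begin
          (x + y) ^ suc p                                  ≈⟨ Binomial.theorem (suc p) x y ⟩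
          term zero + Sum.sum (λ i → term (suc i))         ≈⟨ +-congˡ (Sum.sum-init-last (λ i → term (suc i))) ⟩
          term zero + (Sum.sum (λ i → term (suc (inject₁ i))) + term (suc (fromℕ p)))
            ≈⟨ +-cong first (+-cong middle final) ⟩
          y ^ suc p + (0# + x ^ suc p)                     ≈⟨ +-congˡ (+-identityˡ _) ⟩
          y ^ suc p + x ^ suc p                            ≈⟨ +-comm _ _ ⟩
          x ^ suc p + y ^ suc p                            ∎
          where
          module Binomial = BinomialTheorem commutativeSemiring
          term : Fin (suc (suc p)) → Carrier
          term = Binomial.binomialTerm x y (suc p)

          first : term zero ≈ y ^ suc p
          first = trans (×-homo-1 _) (*-identityˡ _)

          middle : Sum.sum (λ i → term (suc (inject₁ i))) ≈ 0#
          middle = trans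
            (Sum.sum-cong-≋ (λ i → kill (p∣pCk pr (suc (toℕ (inject₁ i))) (s≤s z≤n)
              (s≤s (≡.subst (_< p) (≡.sym (toℕ-inject₁ i)) (toℕ<n i)))) _))
            (Sum.sum-replicate-zero p)

          final : term (suc (fromℕ p)) ≈ x ^ suc p
          final = begin
            (suc p C suc (toℕ (fromℕ p))) · (x ^ suc (toℕ (fromℕ p)) * y ^ (p ∸ toℕ (fromℕ p)))
              ≡⟨ ≡.cong (λ j → (suc p C suc j) · (x ^ suc j * y ^ (p ∸ j))) (toℕ-fromℕ p) ⟩
            (suc p C suc p) · (x ^ suc p * y ^ (p ∸ p))
              ≡⟨ ≡.cong₂ (λ m j → m · (x ^ suc p * y ^ j)) (nCn≡1 (suc p)) (ℕ.n∸n≡0 p) ⟩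
            1 · (x ^ suc p * 1#)   ≈⟨ ×-homo-1 _ ⟩
            x ^ suc p * 1#         ≈⟨ *-identityʳ _ ⟩
            x ^ suc p              ∎

      frobenius^k-+ : ∀ k x y → (x + y) ^ (p ℕ.^ k) ≈ x ^ (p ℕ.^ k) + y ^ (p ℕ.^ k)
      frobenius^k-+ zero    x y = trans (*-identityʳ _) (sym (+-cong (*-identityʳ _) (*-identityʳ _)))
      frobenius^k-+ (suc k) x y = begin
        (x + y) ^ (p ℕ.* p ℕ.^ k)                       ≈⟨ ^-assocʳ (x + y) p (p ℕ.^ k) ⟨
        ((x + y) ^ p) ^ (p ℕ.^ k)                       ≈⟨ ^-congˡ (p ℕ.^ k) (frobenius-+ x y) ⟩
        (x ^ p + y ^ p) ^ (p ℕ.^ k)                     ≈⟨ frobenius^k-+ k (x ^ p) (y ^ p) ⟩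
        (x ^ p) ^ (p ℕ.^ k) + (y ^ p) ^ (p ℕ.^ k)       ≈⟨ +-cong (^-assocʳ x p (p ℕ.^ k)) (^-assocʳ y p (p ℕ.^ k)) ⟩
        x ^ (p ℕ.* p ℕ.^ k) + y ^ (p ℕ.* p ℕ.^ k)       ∎

      0<p^k : ∀ k → 0 < p ℕ.^ k
      0<p^k = positive pr
        where
        positive : ∀ {p} → Prime p → ∀ k → 0 < p ℕ.^ k
        positive {zero}  pr k = contradiction pr ¬prime[0]
        positive {suc p} pr k = ℕ.m^n>0 (suc p) k

    frobenius^k-sum : ∀ k {m} (t : Fin m → Carrier) →
                      Sum.sum t ^ (p ℕ.^ k) ≈ Sum.sum (λ i → t i ^ (p ℕ.^ k))
    frobenius^k-sum k {zero}  t = 0^m≈0 (p ℕ.^ k) (0<p^k k)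
    frobenius^k-sum k {suc m} t = trans (frobenius^k-+ k _ _) (+-congˡ (frobenius^k-sum k (λ i → t (suc i))))

  trace-fixed : ∀ q n → IsPrimePower q → N ≡ q ℕ.^ n →
                ∀ x → traceFormula rawSemiring q n x ^ q ≈ traceFormula rawSemiring q n x
  trace-fixed q n (p , k , pr , _ , ≡.refl) N≡q^n x = +-cancelˡ x _ _ (begin
    x + Sum.sum t ^ q                                          ≈⟨ +-congˡ (frobenius^k-sum pr p·1≈0 k t) ⟩
    x + Sum.sum (λ i → t i ^ q)                                ≈⟨ +-cong (sym (*-identityʳ x)) (Sum.sum-cong-≋ next) ⟩
    Sum.sum {suc n} (λ i → x ^ (q ℕ.^ toℕ i))                  ≈⟨ Sum.sum-init-last {n} (λ i → x ^ (q ℕ.^ toℕ i)) ⟩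
    Sum.sum {n} (λ i → x ^ (q ℕ.^ toℕ (inject₁ i))) + x ^ (q ℕ.^ toℕ (fromℕ n))
      ≈⟨ +-cong (Sum.sum-cong-≋ {n} (λ i → ^-congʳ x (≡.cong (q ℕ.^_) (toℕ-inject₁ i)))) top ⟩
    Sum.sum t + x                                              ≈⟨ +-comm _ _ ⟩
    x + Sum.sum t                                              ∎)
    where
    t : Fin n → Carrier
    t i = x ^ (q ℕ.^ toℕ i)

    p·1≈0 : p · 1# ≈ 0#
    p·1≈0 = p^j·1≈0⇒p·1≈0 p (k ℕ.* n) (trans
      (×-congˡ (≡.trans (≡.sym (ℕ.^-*-assoc p k n)) (≡.sym N≡q^n))) N·1≈0)

    next : ∀ i → t i ^ q ≈ x ^ (q ℕ.^ suc (toℕ i))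
    next i = trans (^-assocʳ x (q ℕ.^ toℕ i) q) (^-congʳ x (ℕ.*-comm (q ℕ.^ toℕ i) q))

    top : x ^ (q ℕ.^ toℕ (fromℕ n)) ≈ x
    top = trans (^-congʳ x (≡.trans (≡.cong (q ℕ.^_) (toℕ-fromℕ n)) (≡.sym N≡q^n))) (x^N≈x x)

-- Polynomials over L are coefficient lists, constant term first; trailing
-- zeros are allowed, so equality compares coefficients.
module Polynomials {N : ℕ} (L : FiniteField c ℓ₁ ℓ₂ N) where

  open FiniteField L

  Polynomial : Set c
  Polynomial = List Carrier

  coefficient : Polynomial → ℕ → Carrier
  coefficient []      _       = 0#
  coefficient (a ∷ f) zero    = a
  coefficient (a ∷ f) (suc k) = coefficient f k

  infix  4 _≈ᴾ_
  infixl 6 _+ᴾ_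
  infixl 7 _*ᴾ_

  _≈ᴾ_ : Polynomial → Polynomial → Set ℓ₁
  f ≈ᴾ g = ∀ k → coefficient f k ≈ coefficient g k

  const : Carrier → Polynomial
  const a = a ∷ []

  X : Polynomial
  X = 0# ∷ 1# ∷ []

  _+ᴾ_ : Polynomial → Polynomial → Polynomial
  []      +ᴾ g       = g
  (a ∷ f) +ᴾ []      = a ∷ f
  (a ∷ f) +ᴾ (b ∷ g) = (a + b) ∷ (f +ᴾ g)

  _*ᴾ_ : Polynomial → Polynomial → Polynomial
  []      *ᴾ g = []
  (a ∷ f) *ᴾ g = map (a *_) g +ᴾ (0# ∷ (f *ᴾ g))

  polynomialRawSemiring : RawSemiring c ℓ₁
  polynomialRawSemiring = record
    { Carrier = Polynomial
    ; _≈_     = _≈ᴾ_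
    ; _+_     = _+ᴾ_
    ; _*_     = _*ᴾ_
    ; 0#      = []
    ; 1#      = const 1#
    }

  eval : Polynomial → Carrier → Carrier
  eval []      x = 0#
  eval (a ∷ f) x = a + x * eval f x

  IsPermutationPolynomial : Polynomial → Set (c ⊔ ℓ₁)
  IsPermutationPolynomial f = Bijective _≈_ _≈_ (eval f)

module TraceMap (q n : ℕ) (pp : IsPrimePower q) (L : FiniteField c ℓ₁ ℓ₂ (q ℕ.^ n)) where

  open FiniteField L
  open FiniteFieldProperties L using (≉⇒#; trace-fixed)
  open Polynomials L
  open RawSemiringDefinitions rawSemiring using (_^_)

  -- The subfield with q elements, as the fixed points of x ↦ x^q.
  𝔽q : Set (c ⊔ ℓ₁)
  𝔽q = Σ[ b ∈ Carrier ] b ^ q ≈ b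

  Tr : Carrier → 𝔽q
  Tr x = traceFormula rawSemiring q n x , trace-fixed q n pp ≡.refl x

  infix 4 _≈q_

  _≈q_ : 𝔽q → 𝔽q → Set ℓ₁
  b ≈q d = proj₁ b ≈ proj₁ d

  -- The numerator u divided by b - d; #⇒invertible inverts the difference
  -- of apart elements, and distinct elements of a finite field are apart.
  _/[_-_]_ : Carrier → (b d : 𝔽q) → ¬ (b ≈q d) → Carrier
  u /[ b - d ] b≉d = u * proj₁ (#⇒invertible (≉⇒# b≉d))

  P : Polynomial → Pred Carrier (c ⊔ ℓ₁)
  P H γ = IsPermutationPolynomial (X +ᴾ const γ *ᴾ traceFormula polynomialRawSemiring q n H)

  S : Polynomial → Pred 𝔽q (c ⊔ ℓ₁)
  S H b = ∃ λ x → Tr (eval H x) ≈q b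

  I : Polynomial → 𝔽q → Pred Carrier ℓ₁
  I H b x = Tr (eval H x) ≈q b

  DistinctPair : Pred 𝔽q (c ⊔ ℓ₁) → Set (c ⊔ ℓ₁)
  DistinctPair A = Σ[ b ∈ 𝔽q ] Σ[ d ∈ 𝔽q ] A b × A d × ¬ (b ≈q d)

  Quotients : (H : Polynomial) → DistinctPair (S H) → Pred Carrier (c ⊔ ℓ₁)
  Quotients H (b , d , _ , _ , b≉d) γ =
    ∃₂ λ x y → I H b x × I H d y × γ ≈ (y - x) /[ b - d ] b≉d

{-# OPTIONS --safe #-}
-- Write T x = Tr (H x) and F x = x + γ T x.  Clearing denominators, γ = (y - x) / (T x - T y)
-- says exactly that F x = F y, so γ avoids all these quotients if and only if F is injective:
-- a collision with T x = T y already forces x = y.  On a finite field injective maps are bijective.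
module Submission where

open import Defs
open import Data.Nat using (ℕ; _≤_; _^_)
open import Relation.Unary using (_≐_; _∖_; U; ⋃)

import Algebra.Definitions.RawSemiring as RawSemiringDefinitions
import Algebra.Properties.CommutativeMonoid.Sum as CommutativeMonoidSum
import Algebra.Properties.CommutativeSemigroup as CommutativeSemigroupProperties
import Algebra.Properties.CommutativeSemiring.Exp as Exponentiation
import Algebra.Properties.Group as GroupProperties
import Algebra.Properties.Ring as RingProperties
open import Algebra.Bundles using (CommutativeMonoid; CommutativeRing)
open import Data.Fin using (Fin; zero; suc; toℕ; punchOut)
open import Data.Fin.Properties using (any?; injective⇒≤; punchOut-injective)
import Data.Fin.Properties as Fin
open import Data.List using ([]; _∷_; map)
open import Data.Nat using (zero; suc)
import Data.Nat.Properties as ℕ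
open import Data.Product using (∃; _,_; proj₁; proj₂)
open import Function.Base using (_∘_)
open import Function.Bundles using (Inverse)
open import Function.Consequences.Setoid using (strictlySurjective⇒surjective)
open import Function.Definitions using (Congruent; Injective; Bijective)
open import Level using (Level)
open import Relation.Binary.PropositionalEquality as ≡ using (_≡_; _≢_)
import Relation.Binary.Reasoning.Setoid as SetoidReasoning
open import Relation.Nullary using (¬_; yes; no; contradiction)

private
  variable
    c ℓ₁ ℓ₂ : Level

-- Pigeonhole: if `j` were missed, punching it out of the codomain would leave an injection from
-- `Fin (suc n)` into `Fin n`.
injective⇒strictlySurjective : ∀ {n} {f : Fin n → Fin n} → Injective _≡_ _≡_ f →
                               ∀ j → ∃ λ i → f i ≡ j
injective⇒strictlySurjective {suc n} {f} f-injective j with any? (λ i → f i Fin.≟ j)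
... | yes hit  = hit
... | no  miss = contradiction
  (injective⇒≤ (f-injective ∘ punchOut-injective (j≢f _) (j≢f _))) ℕ.1+n≰n
  where
  j≢f : ∀ i → j ≢ f i
  j≢f i j≡fi = miss (i , ≡.sym j≡fi)

-- Clearing denominators in a commutative ring

module LinearEquation (R : CommutativeRing c ℓ₁) where

  open CommutativeRing R
  open GroupProperties +-group using (//-rightDividesˡ; //-rightDividesʳ)
  open RingProperties ring using (x[y-z]≈xy-xz)
  open SetoidReasoning setoid

  slope⇒collision : ∀ {γ b d x y} → γ * (b - d) ≈ y - x → x + γ * b ≈ y + γ * d
  slope⇒collision {γ} {b} {d} {x} {y} slope = begin
    -- Splitting off `γ * d` exposes the difference `γ * b - γ * d`, which the hypothesis turns into
    -- `y - x`.
    x + γ * b                       ≈⟨ +-congˡ (//-rightDividesˡ (γ * d) (γ * b)) ⟨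
    x + (γ * b - γ * d + γ * d)     ≈⟨ +-congˡ (+-congʳ (trans (sym (x[y-z]≈xy-xz γ b d)) slope)) ⟩
    x + (y - x + γ * d)             ≈⟨ +-assoc _ _ _ ⟨
    x + (y - x) + γ * d             ≈⟨ +-congʳ (trans (+-comm _ _) (//-rightDividesˡ x y)) ⟩
    y + γ * d                       ∎

  collision⇒slope : ∀ {γ b d x y} → x + γ * b ≈ y + γ * d → γ * (b - d) ≈ y - x
  collision⇒slope {γ} {b} {d} {x} {y} collision = begin
    γ * (b - d)                     ≈⟨ x[y-z]≈xy-xz γ b d ⟩
    -- Adding and subtracting `x` assembles `x + γ * b`, to which the collision applies.
    γ * b - γ * d                   ≈⟨ //-rightDividesʳ x _ ⟨
    γ * b - γ * d + x - x           ≈⟨ +-congʳ (+-comm _ x) ⟩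
    x + (γ * b - γ * d) - x         ≈⟨ +-congʳ (+-assoc _ _ _) ⟨
    x + γ * b - γ * d - x           ≈⟨ +-congʳ (+-congʳ collision) ⟩
    y + γ * d - γ * d - x           ≈⟨ +-congʳ (//-rightDividesʳ (γ * d) y) ⟩
    y - x                           ∎

  -- Serves both directions of the theorem: with `a` the inverse of a difference `b` it clears a
  -- denominator, and with the roles exchanged it introduces one.
  cancelInverse : ∀ {a b} u → a * b ≈ 1# → u * a * b ≈ u
  cancelInverse {a} {b} u ab≈1 = begin
    u * a * b     ≈⟨ *-assoc u a b ⟩
    u * (a * b)   ≈⟨ *-congˡ ab≈1 ⟩
    u * 1#        ≈⟨ *-identityʳ u ⟩
    u             ∎

-- Self-maps of a finite field

module FiniteFieldMaps {N : ℕ} (L : FiniteField c ℓ₁ ℓ₂ N) where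

  open FiniteField L
  open Inverse enumeration using (to; from; to-cong; strictlyInverseˡ; strictlyInverseʳ)
  open SetoidReasoning setoid

  -- The enumeration carries `f` to a self-map of `Fin N`, where pigeonhole applies. Congruence of
  -- `f` then upgrades strict surjectivity to surjectivity for the setoid equality.
  injective⇒bijective : ∀ {f} → Congruent _≈_ _≈_ f → Injective _≈_ _≈_ f → Bijective _≈_ _≈_ f
  injective⇒bijective {f} f-cong f-injective =
    f-injective , strictlySurjective⇒surjective setoid setoid f-cong preimage
    where
    to-injective : ∀ {x y} → to x ≡ to y → x ≈ y
    to-injective {x} {y} eq = begin
      x             ≈⟨ strictlyInverseʳ x ⟨
      from (to x)   ≡⟨ ≡.cong from eq ⟩
      from (to y)   ≈⟨ strictlyInverseʳ y ⟩
      y             ∎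

    from-injective : ∀ {i j} → from i ≈ from j → i ≡ j
    from-injective {i} {j} eq =
      ≡.trans (≡.sym (strictlyInverseˡ i)) (≡.trans (to-cong eq) (strictlyInverseˡ j))

    preimage : ∀ y → ∃ λ x → f x ≈ y
    -- The map on indices is `to ∘ f ∘ from`, inferred from this composite of injectivity proofs.
    preimage y with injective⇒strictlySurjective
                      (from-injective ∘ f-injective ∘ to-injective) (to y)
    ... | i , eq = from i , to-injective eq

-- Evaluation as a semiring homomorphism

module Evaluation {N : ℕ} (L : FiniteField c ℓ₁ ℓ₂ N) where

  open CommutativeMonoid using (commutativeSemigroup)
  open FiniteField L
  open Polynomials L
  open CommutativeSemigroupProperties (commutativeSemigroup +-commutativeMonoid) using (interchange)
  open CommutativeSemigroupProperties (commutativeSemigroup *-commutativeMonoid)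
    using () renaming (x∙yz≈y∙xz to x*yz≈y*xz)
  open Exponentiation commutativeSemiring using (^-congˡ)
  open RawSemiringDefinitions rawSemiring using () renaming (_^_ to _^ᴸ_; sum to sumᴸ)
  open RawSemiringDefinitions polynomialRawSemiring using () renaming (_^_ to _^ᴾ_; sum to sumᴾ)
  open SetoidReasoning setoid
  private
    module Sum = CommutativeMonoidSum +-commutativeMonoid

  eval-cong : ∀ f → Congruent _≈_ _≈_ (eval f)
  eval-cong []      x≈y = refl
  eval-cong (a ∷ f) x≈y = +-congˡ (*-cong x≈y (eval-cong f x≈y))

  eval-const : ∀ a x → eval (const a) x ≈ a
  eval-const a x = trans (+-congˡ (zeroʳ x)) (+-identityʳ a)

  eval-X : ∀ x → eval X x ≈ x
  eval-X x = trans (+-identityˡ _) (trans (*-congˡ (eval-const 1# x)) (*-identityʳ x))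

  eval-+ᴾ : ∀ f g x → eval (f +ᴾ g) x ≈ eval f x + eval g x
  eval-+ᴾ []      g       x = sym (+-identityˡ _)
  eval-+ᴾ (a ∷ f) []      x = sym (+-identityʳ _)
  eval-+ᴾ (a ∷ f) (b ∷ g) x = begin
    a + b + x * eval (f +ᴾ g) x                  ≈⟨ +-congˡ (*-congˡ (eval-+ᴾ f g x)) ⟩
    a + b + x * (eval f x + eval g x)            ≈⟨ +-congˡ (distribˡ x _ _) ⟩
    a + b + (x * eval f x + x * eval g x)        ≈⟨ interchange a b _ _ ⟩
    a + x * eval f x + (b + x * eval g x)        ∎

  eval-map-* : ∀ a f x → eval (map (a *_) f) x ≈ a * eval f x
  eval-map-* a []      x = sym (zeroʳ a)
  eval-map-* a (b ∷ f) x = begin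
    a * b + x * eval (map (a *_) f) x   ≈⟨ +-congˡ (*-congˡ (eval-map-* a f x)) ⟩
    a * b + x * (a * eval f x)          ≈⟨ +-congˡ (x*yz≈y*xz x a _) ⟩
    a * b + a * (x * eval f x)          ≈⟨ distribˡ a b _ ⟨
    a * (b + x * eval f x)              ∎

  eval-*ᴾ : ∀ f g x → eval (f *ᴾ g) x ≈ eval f x * eval g x
  eval-*ᴾ []      g x = sym (zeroˡ _)
  eval-*ᴾ (a ∷ f) g x = begin
    -- Prepending `0#` is multiplication by `X`, so the second summand evaluates to `x` times the
    -- value of the shorter product.
    eval (map (a *_) g +ᴾ (0# ∷ f *ᴾ g)) x            ≈⟨ eval-+ᴾ (map (a *_) g) _ x ⟩
    eval (map (a *_) g) x + (0# + x * eval (f *ᴾ g) x)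
      ≈⟨ +-cong (eval-map-* a g x) (trans (+-identityˡ _) (*-congˡ (eval-*ᴾ f g x))) ⟩
    a * eval g x + x * (eval f x * eval g x)          ≈⟨ +-congˡ (*-assoc x _ _) ⟨
    a * eval g x + x * eval f x * eval g x            ≈⟨ distribʳ _ a _ ⟨
    (a + x * eval f x) * eval g x                     ∎

  eval-^ᴾ : ∀ f k x → eval (f ^ᴾ k) x ≈ eval f x ^ᴸ k
  eval-^ᴾ f zero    x = eval-const 1# x
  eval-^ᴾ f (suc k) x = trans (eval-*ᴾ f (f ^ᴾ k) x) (*-congˡ (eval-^ᴾ f k x))

  eval-sumᴾ : ∀ {m} (t : Fin m → Polynomial) x → eval (sumᴾ t) x ≈ sumᴸ (λ i → eval (t i) x)
  eval-sumᴾ {zero}  t x = refl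
  eval-sumᴾ {suc m} t x =
    trans (eval-+ᴾ (t zero) _ x) (+-congˡ (eval-sumᴾ (λ i → t (suc i)) x))

  eval-X+const*ᴾ : ∀ a f x → eval (X +ᴾ const a *ᴾ f) x ≈ x + a * eval f x
  eval-X+const*ᴾ a f x = trans (eval-+ᴾ X (const a *ᴾ f) x)
    (+-cong (eval-X x) (trans (eval-*ᴾ (const a) f x) (*-congʳ (eval-const a x))))

  module _ (q n : ℕ) where

    traceFormula-cong : Congruent _≈_ _≈_ (traceFormula rawSemiring q n)
    traceFormula-cong x≈y = Sum.sum-cong-≋ {n} (λ i → ^-congˡ (q ^ toℕ i) x≈y)

    -- One formula, made of sums and powers, is read in two semirings, and evaluation preserves both
    -- operations. This links the polynomial in `P` to the trace values in `S` and `I`.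
    eval-traceFormula : ∀ f x → eval (traceFormula polynomialRawSemiring q n f) x ≈
                                traceFormula rawSemiring q n (eval f x)
    eval-traceFormula f x = trans (eval-sumᴾ {n} _ x)
      (Sum.sum-cong-≋ {n} (λ i → eval-^ᴾ f (q ^ toℕ i) x))

theorem2p1 : ∀ {c ℓ₁ ℓ₂} (q n : ℕ) (pp : IsPrimePower q) → 1 ≤ n →
    (L : FiniteField c ℓ₁ ℓ₂ (q ^ n)) (H : Polynomials.Polynomial L) →
    let open TraceMap q n pp L in
    P H ≐ U ∖ ⋃ (DistinctPair (S H)) (Quotients H)
theorem2p1 q n pp _ L H = P⊆avoiding , avoiding⊆P
  where
  open FiniteField L
  open FiniteFieldProperties L using (≉⇒#; _≟_)
  open FiniteFieldMaps L
  open Polynomials L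
  open TraceMap q n pp L
  open Evaluation L
  open LinearEquation commutativeRing
  open GroupProperties +-group using () renaming (∙-cancelʳ to +-cancelʳ)

  -- Trace values are taken in the large field, since `_≈q_` compares only the underlying elements.
  T : Carrier → Carrier
  T x = proj₁ (Tr (eval H x))

  T-cong : Congruent _≈_ _≈_ T
  T-cong = traceFormula-cong q n ∘ eval-cong H

  TrH : Polynomial
  TrH = traceFormula polynomialRawSemiring q n H

  F : Carrier → Polynomial
  F γ = X +ᴾ const γ *ᴾ TrH

  eval-F : ∀ γ x → eval (F γ) x ≈ x + γ * T x
  eval-F γ x = trans (eval-X+const*ᴾ γ TrH x) (+-congˡ (*-congˡ (eval-traceFormula q n H x)))

  P⊆avoiding : ∀ {γ} → P H γ → (U ∖ ⋃ (DistinctPair (S H)) (Quotients H)) γ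
  P⊆avoiding {γ} (F-injective , _) = _ , avoids
    where
    avoids : ¬ ⋃ (DistinctPair (S H)) (Quotients H) γ
    avoids ((b , d , _ , _ , b≉d) , x , y , Tx≈b , Ty≈d , γ≈) =
      -- The collision forces `x ≈ y`, so the trace values `b` and `d` would agree.
      b≉d (trans (sym Tx≈b) (trans (T-cong (F-injective Fx≈Fy)) Ty≈d))
      where
      slope : γ * (proj₁ b - proj₁ d) ≈ y - x
      slope = trans (*-congʳ γ≈)
        (cancelInverse (y - x) (proj₁ (proj₂ (#⇒invertible (≉⇒# b≉d)))))

      Fx≈Fy : eval (F γ) x ≈ eval (F γ) y
      -- Membership in `I` gives the trace values only up to `≈`, so `T x` and `T y` are exchanged
      -- for `b` and `d` around the slope argument.
      Fx≈Fy = trans (eval-F γ x) (trans (+-congˡ (*-congˡ Tx≈b)) (trans (slope⇒collision slope)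
        (trans (+-congˡ (*-congˡ (sym Ty≈d))) (sym (eval-F γ y)))))

  avoiding⊆P : ∀ {γ} → (U ∖ ⋃ (DistinctPair (S H)) (Quotients H)) γ → P H γ
  avoiding⊆P {γ} (_ , avoids) = injective⇒bijective (eval-cong (F γ)) F-injective
    where
    collision : ∀ {x y} → eval (F γ) x ≈ eval (F γ) y → x + γ * T x ≈ y + γ * T y
    collision {x} {y} Fx≈Fy = trans (sym (eval-F γ x)) (trans Fx≈Fy (eval-F γ y))

    F-injective : Injective _≈_ _≈_ (eval (F γ))
    F-injective {x} {y} Fx≈Fy with T x ≟ T y
    -- With equal trace values both sides carry the same shift `γ * T y`, which cancels.
    ... | yes Tx≈Ty = +-cancelʳ (γ * T y) x y (trans (+-congˡ (*-congˡ (sym Tx≈Ty))) (collision Fx≈Fy))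
    -- The excluded quotient has `b` and `d` equal to the traces at `x` and `y` themselves, so all
    -- memberships in `S` and `I` hold by reflexivity.
    ... | no  Tx≉Ty = contradiction
      ( (Tr (eval H x) , Tr (eval H y) , (x , refl) , (y , refl) , Tx≉Ty)
      , x , y , refl , refl , γ≈) avoids
      where
      γ≈ : γ ≈ (y - x) /[ Tr (eval H x) - Tr (eval H y) ] Tx≉Ty
      γ≈ = trans (sym (cancelInverse γ (proj₂ (proj₂ (#⇒invertible (≉⇒# Tx≉Ty))))))
        (*-congʳ (collision⇒slope (collision Fx≈Fy)))
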